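{- For every binary relation $B$ on $R$ the following hold. (1) $op_B$ is idempotent. (2) $op_B$ is associative if and only if both $B$ and its complement are transitive. (3) $op_B$ is left-biased if and only if $B$ is strongly connected. (4) $op_B$ is right-biased if and only if the complement of $B$ is strongly connected. (5) $op_B$ is not commutative (assuming $R$ is non-empty).
   Context: $T$ is a (necessarily strong) monad on the category of sets, and $R$ is a set carrying a $T$-algebra structure $\alpha_T:T(R)\to R$. Put $S_T(X)=(X\to R)\to T(X)$ (the selection monad augmented with the auxiliary monad $T$). For $F\in S_T(X)$ and $\gamma:X\to R$ put $\mathbf R(F|\gamma)=\alpha_T(T(\gamma)(F(\gamma)))\in R$. For a binary relation $B$ on $R$, $op_B$ is the family of binary operations $(op_B)_X:S_T(X)^2\to S_T(X)$ (one for every set $X$) given by: $(op_B)_X(G_0,G_1)(\gamma)=G_0(\gamma)$ if $\mathbf R(G_0|\gamma)\;B\;\mathbf R(G_1|\gamma)$, and $(op_B)_X(G_0,G_1)(\gamma)=G_1(\gamma)$ otherwise. The family $op_B$ is said to satisfy an equation (be idempotent, associative, commutative, left-biased, right-biased) if $(op_B)_X$ does for every set $X$. A binary function $f$ is left-biased if $f(x,f(y,x))=f(x,y)$ for all $x,y$, and right-biased if $f(f(x,y),x)=f(y,x)$ for all $x,y$. A relation $Q$ is strongly connected if for all $x,y$ either $xQy$ or $yQx$.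
   Formalization: Parts (3)–(5) assume that, if R is non-empty, some T(X) has two distinct elements (they can fail for T(X)=1 with R a singleton); B is assumed decidable, which is automatic classically. -}

module Defs where

open import Level using (Level; suc)
open import Algebra.Core using (Op₂)
open import Data.Bool.Base using (if_then_else_)
open import Data.Product.Base using (∃; ∃₂)
open import Function.Base using (id; _∘_)
open import Relation.Binary.Core using (Rel)
open import Relation.Binary.Definitions using (Decidable)
open import Relation.Binary.PropositionalEquality.Core using (_≗_; _≢_)
open import Relation.Nullary.Decidable.Core using (does)
open import Relation.Nullary.Negation.Core using (¬_)

-- Morphisms of the category of sets are compared pointwise; `map-cong` says
-- that the functor respects this equality.  Strength is canonical on sets
-- and need not be recorded.
record Monad (ℓ : Level) : Set (suc ℓ) where
  field
    T   : Set ℓ → Set ℓ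
    map : ∀ {X Y : Set ℓ} → (X → Y) → T X → T Y
    η   : ∀ {X : Set ℓ} → X → T X
    μ   : ∀ {X : Set ℓ} → T (T X) → T X

    map-cong : ∀ {X Y : Set ℓ} {f g : X → Y} → f ≗ g → map f ≗ map g
    map-id   : ∀ {X : Set ℓ} → map (id {A = X}) ≗ id
    map-∘    : ∀ {X Y Z : Set ℓ} (g : Y → Z) (f : X → Y) →
               map (g ∘ f) ≗ map g ∘ map f

    η-natural : ∀ {X Y : Set ℓ} (f : X → Y) → map f ∘ η ≗ η ∘ f
    μ-natural : ∀ {X Y : Set ℓ} (f : X → Y) →
                map f ∘ μ ≗ μ ∘ map (map f)

    identityˡ : ∀ {X : Set ℓ} → μ {X} ∘ η ≗ id
    identityʳ : ∀ {X : Set ℓ} → μ {X} ∘ map η ≗ id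
    assoc     : ∀ {X : Set ℓ} → μ {X} ∘ μ ≗ μ ∘ map μ

record Algebra {ℓ : Level} (M : Monad ℓ) (R : Set ℓ) : Set ℓ where
  open Monad M
  field
    α      : T R → R
    unit   : α ∘ η ≗ id
    action : α ∘ μ ≗ α ∘ map α

-- The monads on sets excluded by this condition are those for which every
-- `T X` has at most one element: the constant monad `T X = 1` and its
-- variant with `T ∅ = ∅`.  For these an inhabited `R` is a singleton and `S X`
-- has at most one element, so every operation on `S X` is commutative and
-- biased on both sides, whatever `B` is.
NonTrivial : ∀ {ℓ} → Monad ℓ → Set (suc ℓ)
NonTrivial {ℓ} M = ∃ λ (X : Set ℓ) → ∃₂ λ (s t : T X) → s ≢ t
  where open Monad M

Complement : ∀ {a b} {A : Set a} → Rel A b → Rel A b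
Complement B x y = ¬ B x y

module _ {a ℓ} {A : Set a} (_≈_ : Rel A ℓ) where

  LeftBiased : Op₂ A → Set _
  LeftBiased f = ∀ x y → f x (f y x) ≈ f x y

  RightBiased : Op₂ A → Set _
  RightBiased f = ∀ x y → f (f x y) x ≈ f y x

module Selection {ℓ : Level} (M : Monad ℓ) (R : Set ℓ) (A : Algebra M R) where
  open Monad M
  open Algebra A

  S : Set ℓ → Set ℓ
  S X = (X → R) → T X

  -- Equality of elements of `S X`, that is, extensional equality of functions.
  _≈_ : ∀ {X} → Rel (S X) ℓ
  _≈_ = _≗_

  𝐑⟨_∣_⟩ : ∀ {X} → S X → (X → R) → R
  𝐑⟨ F ∣ γ ⟩ = α (map γ (F γ))

  -- The case distinction defining the operation needs `B` to be decidable,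
  -- which every relation is classically.
  op : ∀ {b} {B : Rel R b} → Decidable B → ∀ X → Op₂ (S X)
  op B? X G₀ G₁ γ = if does (B? 𝐑⟨ G₀ ∣ γ ⟩ 𝐑⟨ G₁ ∣ γ ⟩) then G₀ γ else G₁ γ

{-# OPTIONS --safe #-}
-- At a fixed γ, op acts on the values Gᵢ γ by a choice operation on T X that only looks at
-- their evaluations in R, and the equations of op come down to a case analysis on B.  For
-- the converse directions one tests op on the constant functions at η (inj₁ x) and
-- η (inj₂ y) in T (R ⊎ R), with γ the codiagonal: they evaluate to x and y, while the tags
-- keep them apart even when x and y coincide.  Should two such elements be equal, every
-- T-algebra, in particular R and each free algebra T X, has at most one element.
module Submission where

open import Defs
open import Algebra.Definitions using (Idempotent; Associative; Commutative)
open import Data.Bool.Base using (if_then_else_)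
open import Data.Empty using (⊥-elim)
open import Data.Product.Base using (_×_; _,_)
open import Data.Sum.Base using (_⊎_; inj₁; inj₂; [_,_])
open import Function.Base using (id; const; _∘_)
open import Function.Bundles using (_⇔_; mk⇔)
open import Relation.Binary.Core using (Rel)
open import Relation.Binary.Definitions using (Decidable; Total; Transitive)
open import Relation.Binary.PropositionalEquality
  using (_≡_; refl; sym; trans; cong; subst; subst₂; module ≡-Reasoning)
open import Relation.Nullary.Decidable using (does; yes; no; dec-true; dec-false; decidable-stable)
open import Relation.Nullary.Negation.Core using (¬_)

module Choice {r b} {R : Set r} {B : Rel R b} (B? : Decidable B)
              {y} {Y : Set y} (e : Y → R) where

  open ≡-Reasoning

  infix 4 _≼_ _⋠_

  _≼_ _⋠_ : Rel Y b
  s ≼ t = B (e s) (e t)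
  s ⋠ t = ¬ s ≼ t

  choose : Y → Y → Y
  choose s t = if does (B? (e s) (e t)) then s else t

  choose-≼ : ∀ {s t} → s ≼ t → choose s t ≡ s
  choose-≼ {s} {t} p rewrite dec-true (B? (e s) (e t)) p = refl

  choose-⋠ : ∀ {s t} → s ⋠ t → choose s t ≡ t
  choose-⋠ {s} {t} p rewrite dec-false (B? (e s) (e t)) p = refl

  choose-idem : ∀ s → choose s s ≡ s
  choose-idem s with B? (e s) (e s)
  ... | yes _ = refl
  ... | no  _ = refl

  -- Comparing `s` with `u` matters only when the two adjacent comparisons agree, and there
  -- transitivity of `B` or of its complement settles it. In the mixed cases both bracketings give
  -- `choose s u` or both give `t`.
  choose-assoc : Transitive B → Transitive (Complement B) →
                 ∀ s t u → choose (choose s t) u ≡ choose s (choose t u)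
  choose-assoc B-trans ∁B-trans s t u with B? (e s) (e t) | B? (e t) (e u)
  ... | yes p | yes q = trans (choose-≼ (B-trans p q)) (sym (choose-≼ p))
  ... | yes _ | no  _ = refl
  ... | no  p | yes q = trans (choose-≼ q) (sym (choose-⋠ p))
  ... | no  p | no  q = trans (choose-⋠ q) (sym (choose-⋠ (∁B-trans p q)))

  -- Totality serves the case `s ⋠ t`, where it gives `t ≼ s`, so both choices return `t`. If
  -- `s ≼ t`, the inner choice is `s` or `t`, and `s` wins against either.
  choose-leftBiased : Total B → LeftBiased _≡_ choose
  choose-leftBiased total s t with B? (e s) (e t)
  ... | no p with total (e s) (e t)
  ...   | inj₁ q = ⊥-elim (p q)
  ...   | inj₂ q = trans (cong (choose s) (choose-≼ q)) (choose-⋠ p)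
  choose-leftBiased total s t | yes p with B? (e t) (e s)
  ...   | yes _ = choose-≼ p
  ...   | no  _ = choose-idem s

  choose-rightBiased : Total (Complement B) → RightBiased _≡_ choose
  choose-rightBiased total s t with B? (e s) (e t)
  ... | no  _ = refl
  ... | yes p with total (e s) (e t)
  ...   | inj₁ q = ⊥-elim (q p)
  ...   | inj₂ q = trans (choose-idem s) (sym (choose-⋠ q))

  -- At a failure of transitivity the left bracketing returns `u` and the right one `s`, so
  -- associativity at this one triple identifies them. The next three lemmas draw an identification
  -- from the other failures in the same way.
  ≼-trans-failure : ∀ {s t u} → choose (choose s t) u ≡ choose s (choose t u) →
                    s ≼ t → t ≼ u → s ⋠ u → s ≡ u
  ≼-trans-failure {s} {t} {u} eq st tu su = begin
    s                      ≡⟨ choose-≼ st ⟨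
    choose s t             ≡⟨ cong (choose s) (choose-≼ tu) ⟨
    choose s (choose t u)  ≡⟨ eq ⟨
    choose (choose s t) u  ≡⟨ cong (λ v → choose v u) (choose-≼ st) ⟩
    choose s u             ≡⟨ choose-⋠ su ⟩
    u                      ∎

  ⋠-trans-failure : ∀ {s t u} → choose (choose s t) u ≡ choose s (choose t u) →
                    s ⋠ t → t ⋠ u → s ≼ u → s ≡ u
  ⋠-trans-failure {s} {t} {u} eq st tu su = begin
    s                      ≡⟨ choose-≼ su ⟨
    choose s u             ≡⟨ cong (choose s) (choose-⋠ tu) ⟨
    choose s (choose t u)  ≡⟨ eq ⟨
    choose (choose s t) u  ≡⟨ cong (λ v → choose v u) (choose-⋠ st) ⟩
    choose t u             ≡⟨ choose-⋠ tu ⟩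
    u                      ∎

  ≼-total-failure : ∀ {s t} → choose s (choose t s) ≡ choose s t →
                    s ⋠ t → t ⋠ s → s ≡ t
  ≼-total-failure {s} {t} eq st ts = begin
    s                      ≡⟨ choose-idem s ⟨
    choose s s             ≡⟨ cong (choose s) (choose-⋠ ts) ⟨
    choose s (choose t s)  ≡⟨ eq ⟩
    choose s t             ≡⟨ choose-⋠ st ⟩
    t                      ∎

  ⋠-total-failure : ∀ {s t} → choose (choose s t) s ≡ choose t s →
                    s ≼ t → t ≼ s → s ≡ t
  ⋠-total-failure {s} {t} eq st ts = begin
    s                      ≡⟨ choose-idem s ⟨
    choose s s             ≡⟨ cong (λ v → choose v s) (choose-≼ st) ⟨
    choose (choose s t) s  ≡⟨ eq ⟩
    choose t s             ≡⟨ choose-≼ ts ⟩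
    t                      ∎

  -- `B` cannot tell `s` from `t`, so `choose` returns its first argument in both orders or its
  -- second in both.
  choose-comm⇒≡ : ∀ {s t} → e s ≡ e t → choose s t ≡ choose t s → s ≡ t
  choose-comm⇒≡ {s} {t} es≡et eq with B? (e s) (e t)
  ... | yes p = trans eq (choose-≼ (subst₂ B es≡et (sym es≡et) p))
  ... | no  p = sym (trans eq (choose-⋠ (p ∘ subst₂ B (sym es≡et) es≡et)))

module _ {ℓ} (M : Monad ℓ) where

  open Monad M

  free : ∀ X → Algebra M (T X)
  free X = record { α = μ ; unit = identityˡ ; action = assoc }

  α-map-η : ∀ {X C : Set ℓ} (A : Algebra M C) (f : X → C) (x : X) →
            Algebra.α A (map f (η x)) ≡ f x
  α-map-η A f x = trans (cong (Algebra.α A) (η-natural f x)) (Algebra.unit A (f x))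

  -- The map `f`, constant on each tag, extends to a homomorphism from the free algebra on `X ⊎ Y`,
  -- which sends the two units to the arbitrary elements `c` and `d`.
  tags-collide⇒subsingleton : ∀ {X Y C : Set ℓ} (A : Algebra M C) {x : X} {y : Y} →
                              η (inj₁ x) ≡ η (inj₂ y) → ∀ (c d : C) → c ≡ d
  tags-collide⇒subsingleton {X} {Y} {C} A {x} {y} eq c d = begin
    c                                    ≡⟨ α-map-η A f (inj₁ x) ⟨
    Algebra.α A (map f (η (inj₁ x)))     ≡⟨ cong (Algebra.α A ∘ map f) eq ⟩
    Algebra.α A (map f (η (inj₂ y)))     ≡⟨ α-map-η A f (inj₂ y) ⟩
    d                                    ∎
    where
    open ≡-Reasoning
    f : X ⊎ Y → C
    f = [ const c , const d ]

  tags-distinct : NonTrivial M → ∀ {X Y : Set ℓ} {x : X} {y : Y} →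
                  ¬ η (inj₁ x) ≡ η (inj₂ y)
  tags-distinct (Z , s , t , s≢t) eq = s≢t (tags-collide⇒subsingleton (free Z) eq s t)

module Tests {ℓ b} (M : Monad ℓ) (R : Set ℓ) (A : Algebra M R)
             (B : Rel R b) (B? : Decidable B) where

  open Monad M
  open Algebra A
  open Selection M R A

  codiagonal : R ⊎ R → R
  codiagonal = [ id , id ]

  eval : T (R ⊎ R) → R
  eval = α ∘ map codiagonal

  open Choice B? eval

  eval-η : ∀ z → eval (η z) ≡ codiagonal z
  eval-η = α-map-η M A codiagonal

  η-≼ : ∀ z w → B (codiagonal z) (codiagonal w) → η z ≼ η w
  η-≼ z w = subst₂ B (sym (eval-η z)) (sym (eval-η w))

  η-⋠ : ∀ z w → ¬ B (codiagonal z) (codiagonal w) → η z ⋠ η w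
  η-⋠ z w = _∘ subst₂ B (eval-η z) (eval-η w)

  -- At `codiagonal`, `op` on such constants is `choose` on their values by definition, so equations
  -- of `op` feed directly into the failure lemmas.
  point : R ⊎ R → S (R ⊎ R)
  point z = const (η z)

  assoc⇒transitive : (∀ X → Associative _≈_ (op B? X)) → Transitive B
  assoc⇒transitive op-assoc {x} {y} {z} xBy yBz = decidable-stable (B? x z) λ ¬xBz →
    let collision = ≼-trans-failure
          -- The failure lemma identifies the outer two elements, so these get different tags.
          (op-assoc _ (point (inj₁ x)) (point (inj₁ y)) (point (inj₂ z)) codiagonal)
          (η-≼ (inj₁ x) (inj₁ y) xBy) (η-≼ (inj₁ y) (inj₂ z) yBz)
          (η-⋠ (inj₁ x) (inj₂ z) ¬xBz)
    -- The collision leaves `R` at most one element, so `y` and `z` coincide.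
    in ¬xBz (subst (B x) (tags-collide⇒subsingleton M A collision y z) xBy)

  assoc⇒∁-transitive : (∀ X → Associative _≈_ (op B? X)) → Transitive (Complement B)
  assoc⇒∁-transitive op-assoc {x} {y} {z} ¬xBy ¬yBz xBz =
    let collision = ⋠-trans-failure
          (op-assoc _ (point (inj₁ x)) (point (inj₁ y)) (point (inj₂ z)) codiagonal)
          (η-⋠ (inj₁ x) (inj₁ y) ¬xBy) (η-⋠ (inj₁ y) (inj₂ z) ¬yBz)
          (η-≼ (inj₁ x) (inj₂ z) xBz)
    in ¬xBy (subst (B x) (tags-collide⇒subsingleton M A collision z y) xBz)

  module _ (nonTrivial : R → NonTrivial M) where

    -- An empty `B` on a singleton `R` also fails to be total, so collapsing `R` yields no
    -- contradiction here; it has to come from two distinct elements of some `T X`.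
    leftBiased⇒total : (∀ X → LeftBiased _≈_ (op B? X)) → Total B
    leftBiased⇒total op-left x y with B? x y | B? y x
    ... | yes p | _     = inj₁ p
    ... | no  _ | yes q = inj₂ q
    ... | no  p | no  q = ⊥-elim (tags-distinct M (nonTrivial x)
      (≼-total-failure (op-left _ (point (inj₁ x)) (point (inj₂ y)) codiagonal)
        (η-⋠ (inj₁ x) (inj₂ y) p) (η-⋠ (inj₂ y) (inj₁ x) q)))

    rightBiased⇒∁-total : (∀ X → RightBiased _≈_ (op B? X)) → Total (Complement B)
    rightBiased⇒∁-total op-right x y with B? x y | B? y x
    ... | no  p | _     = inj₁ p
    ... | yes _ | no  q = inj₂ q
    ... | yes p | yes q = ⊥-elim (tags-distinct M (nonTrivial x)
      (⋠-total-failure (op-right _ (point (inj₁ x)) (point (inj₂ y)) codiagonal)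
        (η-≼ (inj₁ x) (inj₂ y) p) (η-≼ (inj₂ y) (inj₁ x) q)))

    ¬comm : R → ¬ (∀ X → Commutative _≈_ (op B? X))
    ¬comm x op-comm = tags-distinct M (nonTrivial x)
      -- Both tags carry the same `x`, so the evaluations agree while the elements of `T (R ⊎ R)`
      -- differ.
      (choose-comm⇒≡ (trans (eval-η (inj₁ x)) (sym (eval-η (inj₂ x))))
        (op-comm _ (point (inj₁ x)) (point (inj₂ x)) codiagonal))

theorem2p6 : ∀ {ℓ b} (M : Monad ℓ) (R : Set ℓ) (A : Algebra M R) (B : Rel R b) (B? : Decidable B) →
    let open Selection M R A in
    (∀ X → Idempotent _≈_ (op B? X))
    × ((∀ X → Associative _≈_ (op B? X)) ⇔ (Transitive B × Transitive (Complement B)))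
    × ((R → NonTrivial M) →
    ((∀ X → LeftBiased _≈_ (op B? X)) ⇔ Total B)
    × ((∀ X → RightBiased _≈_ (op B? X)) ⇔ Total (Complement B))
    × (R → ¬ (∀ X → Commutative _≈_ (op B? X))))
theorem2p6 M R A B B? =
    (λ X F γ → At.choose-idem γ (F γ))
  , mk⇔ assoc⇒transitives transitives⇒assoc
  , λ nonTrivial →
      mk⇔ (leftBiased⇒total nonTrivial)
          (λ total X F G γ → At.choose-leftBiased γ total (F γ) (G γ))
    , mk⇔ (rightBiased⇒∁-total nonTrivial)
          (λ total X F G γ → At.choose-rightBiased γ total (F γ) (G γ))
    , ¬comm nonTrivial
  where
  open Monad M
  open Algebra A
  open Selection M R A
  open Tests M R A B B?
  -- With this evaluation, `op B? X F G γ` is by definition `choose (F γ) (G γ)`, so each equation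
  -- is proved pointwise in `γ`.
  module At {X} (γ : X → R) = Choice B? (α ∘ map γ)

  assoc⇒transitives : (∀ X → Associative _≈_ (op B? X)) →
                      Transitive B × Transitive (Complement B)
  assoc⇒transitives op-assoc = assoc⇒transitive op-assoc , assoc⇒∁-transitive op-assoc

  transitives⇒assoc : Transitive B × Transitive (Complement B) →
                      ∀ X → Associative _≈_ (op B? X)
  transitives⇒assoc (B-trans , ∁B-trans) X F G H γ =
    At.choose-assoc γ B-trans ∁B-trans (F γ) (G γ) (H γ)
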